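{- Let $U=U_1\times\cdots\times U_m$ with $U_i=\{0,1,\dots,|U_i|-1\}$ finite and nonempty. For any set $S\subseteq U$, any one-dimensional minor-subproduct $M$ of $U$, and any $i$, $f_i(S)\le f_i(S[M\downarrow])$. If $S$ is ample, then (1) $f_i(S)=f_i(S[M\downarrow])$ for any $i$, thus $f(S[M\downarrow])=f(S)$; and (2) if $S_*$ is the stable ample set obtained by any complete serial push down $S[1,\dots,m\downarrow]$ of $S$, then $S_*$ is a bouquet of prisms with origin $\mathbf 0=(0,\dots,0)$.
   Context: A box of $U$ is a set $B=B_1\times\cdots\times B_m$ with $\varnothing\ne B_i\subseteq U_i$; its dimension is $\sum_i(|B_i|-1)$. $f_i(S)$ is the number of boxes of dimension $i$ contained in $S$ and $f(S)=(f_0(S),f_1(S),\dots)$. A set $T\subseteq U$ is a bouquet of prisms with origin $v_0$ if $v_0\in T$ and $v_0$ belongs to every inclusion-maximal box contained in $T$. A generalized partition of $U$ is a tuple $\Lambda=(\alpha_1,\dots,\alpha_m)$ with $\alpha_i$ a partition of $U_i$ into nonempty blocks; it defines a partition of $U$ into the boxes $P^1\times\cdots\times P^m$, $P^i\in\alpha_i$, and the minor-subproduct $M(\Lambda)=M_1\times\cdots\times M_m$, where $M_i$ is the set of blocks of $\alpha_i$. $M(\Lambda)$ is shattered by $S\subseteq U$ if $S$ meets every box of the box-partition. A copy of $M(\Lambda)$ is a set $W_1\times\cdots\times W_m$ where $W_i$ consists of exactly one element from each block of $\alpha_i$. $M(\Lambda)$ is strongly shattered by $S$ if $S$ contains a copy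 of it. $S$ is ample if every minor-subproduct of $U$ shattered by $S$ is strongly shattered by $S$. $M(\Lambda)$ is one-dimensional if exactly one $\alpha_i$ has a non-singleton block; then each box $B$ of its box-partition consists of tuples differing only in coordinate $i$, and the push down $S[M\downarrow]$ is the set such that, for each such box $B$, $S[M\downarrow]\cap B$ consists of the $|S\cap B|$ elements of $B$ with the smallest $i$-th coordinates. A set is stable if $S[M\downarrow]=S$ for every one-dimensional $M$. Write $S[i\downarrow]$ for the push down with respect to the minor-subproduct with $\alpha_i=\{U_i\}$ and all other partitions consisting of singletons (the identity if $|U_i|=1$). A complete serial push down of $S$ is $S[1,\dots,m\downarrow]=S[1\downarrow][2\downarrow]\cdots[m\downarrow]$ for any enumeration $1,\dots,m$ of the coordinates; for ample $S$ the result is independent of the enumeration and is a stable ample set.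
   Formalization: Clause (2) is stated for nonempty ample S: the empty set is vacuously ample, but its push down is empty and does not contain the origin, so it is not a bouquet of prisms. -}

module Defs where

open import Data.Bool.Base using (Bool; T)
open import Data.Bool.Properties using (T?)
open import Data.Fin.Base using (Fin; zero; suc)
open import Data.Fin.Permutation using (Permutation′; _⟨$⟩ʳ_)
import Data.Fin.Properties as Fin
open import Data.Fin.Properties using (_<?_)
open import Data.Fin.Subset as Sub using (Subset; Nonempty; inside; outside; ⊤; ⁅_⁆; ∣_∣)
open import Data.Fin.Subset.Properties
  using (_∈?_; nonempty?; ∈⊤; x∈⁅x⁆; x∈⁅y⁆⇒x≡y)
open import Data.List.Base as List using (List; []; _∷_; allFin; cartesianProductWith; filter; foldl; length)
open import Data.List.Membership.Propositional using (_∈_)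
open import Data.List.Membership.Propositional.Properties using (∈-allFin; ∈-cartesianProductWith⁺)
open import Data.List.Relation.Unary.All using ([]; _∷_)
open import Data.List.Relation.Unary.AllPairs using ([]; _∷_)
open import Data.List.Relation.Unary.Any using (here; there)
open import Data.List.Relation.Unary.Unique.Propositional using (Unique)
open import Data.List.Relation.Unary.Unique.Propositional.Properties using (allFin⁺; cartesianProductWith⁺)
open import Data.Nat.Base using (ℕ; zero; suc; _∸_)
import Data.Nat.Properties as ℕ
open import Data.Product.Base using (∃; _×_; _,_; proj₁)
open import Data.Product using (∃!)
open import Data.Vec.Base as Vec using (Vec; []; _∷_)
open import Data.Vec.Relation.Unary.All using (All; []; _∷_; universal)
open import Data.Vec.Relation.Unary.All.Properties renaming (lookup⁺ to infixl 9 _!_) using ()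
open import Relation.Binary.PropositionalEquality.Core using (_≡_; _≢_; refl)
open import Relation.Nullary.Decidable using (Dec; does; map′; _×-dec_; _→-dec_)
open import Relation.Unary using (Pred; Decidable)
open import Level using (0ℓ)

private
  variable
    m n : ℕ
    ks  : Vec ℕ m

-- The i-th entry k of ks encodes the factor U_i = Fin (suc k), which makes
-- every U_i nonempty.  Tuples are `All`s rather than dependent functions so
-- that propositional equality of points and of boxes is extensional.

Point : Vec ℕ m → Set
Point = All (λ k → Fin (suc k))

Box : Vec ℕ m → Set
Box = All (λ k → Subset (suc k))

Region : Vec ℕ m → Set
Region ks = Point ks → Bool

origin : Point ks
origin {ks = ks} = universal (λ _ → zero) ks

infix 4 _∈ʳ_ _∈ᵇ_ _⊆ʳ_ _⊆ᵇ_

_∈ʳ_ : Point ks → Region ks → Set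
x ∈ʳ S = T (S x)

_∈ᵇ_ : Point ks → Box ks → Set
x ∈ᵇ B = ∀ i → x ! i Sub.∈ B ! i

_⊆ʳ_ : Box ks → Region ks → Set
B ⊆ʳ S = ∀ x → x ∈ᵇ B → x ∈ʳ S

_⊆ᵇ_ : Box ks → Box ks → Set
B ⊆ᵇ C = ∀ x → x ∈ᵇ B → x ∈ᵇ C

-- `Box` itself allows empty sides; the boxes of the theory are those with
-- `IsBox`.
IsBox : Box ks → Set
IsBox B = ∀ i → Nonempty (B ! i)

dim : Box ks → ℕ
dim B = Vec.sum (Vec.tabulate λ i → ∣ B ! i ∣ ∸ 1)

∀point? : {P : Pred (Point ks) 0ℓ} → Decidable P → Dec (∀ x → P x)
∀point? {ks = []}     P? = map′ (λ { p [] → p }) (λ p → p []) (P? [])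
∀point? {ks = k ∷ ks} P? =
  map′ (λ { p (a ∷ x) → p a x }) (λ p a x → p (a ∷ x))
       (Fin.all? λ a → ∀point? λ x → P? (a ∷ x))

_∈ᵇ?_ : (x : Point ks) (B : Box ks) → Dec (x ∈ᵇ B)
x ∈ᵇ? B = Fin.all? λ i → x ! i ∈? B ! i

_⊆ʳ?_ : (B : Box ks) (S : Region ks) → Dec (B ⊆ʳ S)
B ⊆ʳ? S = ∀point? λ x → (x ∈ᵇ? B) →-dec T? (S x)

isBox? : (B : Box ks) → Dec (IsBox B)
isBox? B = Fin.all? λ i → nonempty? (B ! i)

tuples : {P : ℕ → Set} → (∀ k → List (P k)) → (ks : Vec ℕ m) → List (All P ks)
tuples enum []       = [] ∷ []
tuples enum (k ∷ ks) = cartesianProductWith _∷_ (enum k) (tuples enum ks)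

subsets : ∀ n → List (Subset n)
subsets zero    = [] ∷ []
subsets (suc n) = cartesianProductWith _∷_ (outside ∷ inside ∷ []) (subsets n)

points : (ks : Vec ℕ m) → List (Point ks)
points = tuples λ k → allFin (suc k)

boxes : (ks : Vec ℕ m) → List (Box ks)
boxes = tuples λ k → subsets (suc k)

subsets-complete : ∀ {n} (p : Subset n) → p ∈ subsets n
subsets-complete []      = here refl
subsets-complete (s ∷ p) = ∈-cartesianProductWith⁺ _∷_ (sides-complete s) (subsets-complete p)
  where
  sides-complete : ∀ s → s ∈ outside ∷ inside ∷ []
  sides-complete outside = here refl
  sides-complete inside  = there (here refl)

subsets-unique : ∀ n → Unique (subsets n)
subsets-unique zero    = [] ∷ []
subsets-unique (suc n) =
  cartesianProductWith⁺ _∷_ (λ { refl → refl , refl })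
    (((λ ()) ∷ []) ∷ [] ∷ []) (subsets-unique n)

tuples-complete : {P : ℕ → Set} {enum : ∀ k → List (P k)} →
                  (∀ {k} (p : P k) → p ∈ enum k) →
                  (t : All P ks) → t ∈ tuples enum ks
tuples-complete complete []      = here refl
tuples-complete complete (p ∷ t) =
  ∈-cartesianProductWith⁺ _∷_ (complete p) (tuples-complete complete t)

tuples-unique : {P : ℕ → Set} {enum : ∀ k → List (P k)} →
                (∀ k → Unique (enum k)) →
                (ks : Vec ℕ m) → Unique (tuples enum ks)
tuples-unique unique []       = [] ∷ []
tuples-unique unique (k ∷ ks) =
  cartesianProductWith⁺ _∷_ (λ { refl → refl , refl })
    (unique k) (tuples-unique unique ks)

points-complete : (x : Point ks) → x ∈ points ks
points-complete = tuples-complete ∈-allFin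

points-unique : (ks : Vec ℕ m) → Unique (points ks)
points-unique = tuples-unique λ k → allFin⁺ (suc k)

boxes-complete : (B : Box ks) → B ∈ boxes ks
boxes-complete = tuples-complete subsets-complete

boxes-unique : (ks : Vec ℕ m) → Unique (boxes ks)
boxes-unique = tuples-unique λ k → subsets-unique (suc k)

count : {P : Pred (Point ks) 0ℓ} → Decidable P → ℕ
count {ks = ks} P? = length (filter P? (points ks))

f : Region ks → ℕ → ℕ
f {ks = ks} S i =
  length (filter (λ B → isBox? B ×-dec (dim B ℕ.≟ i) ×-dec (B ⊆ʳ? S)) (boxes ks))

MaximalBox : Region ks → Box ks → Set
MaximalBox S B =
  IsBox B × B ⊆ʳ S × (∀ C → IsBox C → C ⊆ʳ S → B ⊆ᵇ C → C ⊆ᵇ B)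

BouquetOfPrisms : Region ks → Point ks → Set
BouquetOfPrisms S v = v ∈ʳ S × (∀ B → MaximalBox S B → v ∈ᵇ B)

-- Nonemptiness and disjointness make the indexing of the blocks injective, so
-- `Fin size` is the set of blocks.
record Partition (n : ℕ) : Set where
  field
    size     : ℕ
    block    : Fin size → Subset n
    nonempty : ∀ b → Nonempty (block b)
    unique   : ∀ x → ∃! _≡_ λ b → x Sub.∈ block b

  blockOf : Fin n → Fin size
  blockOf x = proj₁ (unique x)

open Partition

indiscrete : ∀ k → Partition (suc k)
indiscrete k = record
  { size     = 1
  ; block    = λ _ → ⊤
  ; nonempty = λ _ → zero , ∈⊤
  ; unique   = λ _ → zero , ∈⊤ , λ { {zero} _ → refl }
  }

discrete : ∀ n → Partition n
discrete n = record
  { size     = n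
  ; block    = ⁅_⁆
  ; nonempty = λ x → x , x∈⁅x⁆ x
  ; unique   = λ x → x , x∈⁅x⁆ x , λ x∈ → x∈⁅y⁆⇒x≡y _ x∈
  }

GenPartition : Vec ℕ m → Set
GenPartition = All (λ k → Partition (suc k))

-- The points of M(Λ), each of which names a box of the box-partition of U.
Minor : {ks : Vec ℕ m} → GenPartition ks → Set
Minor {m} Λ = (i : Fin m) → Fin (size (Λ ! i))

InCell : (Λ : GenPartition ks) → Minor Λ → Point ks → Set
InCell Λ c x = ∀ i → x ! i Sub.∈ block (Λ ! i) (c i)

inCell? : (Λ : GenPartition ks) (c : Minor Λ) → Decidable (InCell Λ c)
inCell? Λ c x = Fin.all? λ i → x ! i ∈? block (Λ ! i) (c i)

cellOf : (Λ : GenPartition ks) → Point ks → Minor Λ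
cellOf Λ x i = blockOf (Λ ! i) (x ! i)

Shattered : GenPartition ks → Region ks → Set
Shattered Λ S = ∀ c → ∃ λ x → InCell Λ c x × x ∈ʳ S

IsCopy : GenPartition ks → Box ks → Set
IsCopy Λ W = ∀ i b → ∃! _≡_ λ a → a Sub.∈ W ! i × a Sub.∈ block (Λ ! i) b

StronglyShattered : GenPartition ks → Region ks → Set
StronglyShattered Λ S = ∃ λ W → IsCopy Λ W × W ⊆ʳ S

Ample : Region ks → Set
Ample {ks = ks} S = (Λ : GenPartition ks) → Shattered Λ S → StronglyShattered Λ S

HasNonSingletonBlock : Partition n → Set
HasNonSingletonBlock α = ∃ λ b → ∣ block α b ∣ ≢ 1

OneDimensional : GenPartition ks → Set
OneDimensional Λ = ∃! _≡_ λ i → HasNonSingletonBlock (Λ ! i)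

-- Let C be the box of the box-partition containing x.  When the points of C
-- differ only in coordinate i, x is among the |S ∩ C| elements of C with the
-- smallest i-th coordinates iff fewer than |S ∩ C| elements of C have an i-th
-- coordinate below that of x.
pushAlong : {ks : Vec ℕ m} → GenPartition ks → Fin m → Region ks → Region ks
pushAlong Λ i S x =
  does (count (λ y → inC? y ×-dec (y ! i <? x ! i)) ℕ.<? count (λ y → inC? y ×-dec T? (S y)))
  where inC? = inCell? Λ (cellOf Λ x)

infixl 8 _[_,_↓] _[_↓]

_[_,_↓] : Region ks → (Λ : GenPartition ks) → OneDimensional Λ → Region ks
S [ Λ , (i , _) ↓] = pushAlong Λ i S

axis : {ks : Vec ℕ m} → Fin m → GenPartition ks
axis {ks = k ∷ ks} zero    = indiscrete k ∷ universal (λ k → discrete (suc k)) ks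
axis {ks = k ∷ ks} (suc i) = discrete (suc k) ∷ axis i

-- If |U_i| = 1 then `axis i` is not one-dimensional; its cells are then single
-- points, so this is the identity.
_[_↓] : {ks : Vec ℕ m} → Region ks → Fin m → Region ks
S [ i ↓] = pushAlong (axis i) i S

serialPush : {ks : Vec ℕ m} → Permutation′ m → Region ks → Region ks
serialPush {m} σ S = foldl _[_↓] S (List.map (σ ⟨$⟩ʳ_) (allFin m))

-- Write S_y for the fibre of S over a point y of the remaining coordinates.  A
-- box B × A lies in S iff A lies in the intersection of the S_y with y ∈ B.
-- Within a block of the partition of the pushed coordinate, pushing down turns
-- each S_y into an initial segment of the same size, so the intersection becomes
-- the smallest of these segments and cannot shrink.  An injection of the subsets
-- of the old intersection into those of the new one then gives f S ≤ f S↓.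
--
-- If S is ample then so is its trace on every subproduct.  If each S_y met the
-- block P outside the common intersection C, ampleness of the trace on
-- B × (P \ C) would give an element of P \ C common to all S_y.  So some S_y ∩ P
-- equals C ∩ P, and the intersection does not grow either.
--
-- Pushing down coordinate j makes S closed under resetting coordinate j to 0 and
-- preserves closure under resetting any other coordinate.  A box in a set closed
-- under all these resets can be enlarged by 0 in every side.
module Submission where

-- Renamed because, with _,_ in scope, S [ Λ , d ↓] would also parse as _[_↓] applied to a pair.
open import Defs renaming (_[_↓] to infixl 8 _↓_)
open import Data.Nat using (ℕ; _≤_)
open import Data.Vec using (Vec)
open import Data.Product using (∃; _×_)
open import Data.Fin.Permutation using (Permutation′)
open import Relation.Binary.PropositionalEquality using (_≗_)

open import Data.Bool.Base using (if_then_else_)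
open import Data.Bool.Properties using (T?)
open import Data.Fin.Base using (Fin; zero; suc; _<_)
open import Data.Fin.Permutation using (_⟨$⟩ʳ_; _⟨$⟩ˡ_; inverseʳ)
import Data.Fin.Properties as Fin
open import Data.Fin.Properties using (_≟_; suc-injective; _<?_)
open import Data.Fin.Subset
  using (Subset; inside; outside; Nonempty; ⊥; ⊤; ⁅_⁆; _∈_; _∉_; _⊆_; _∩_; _∪_; _-_; ∁; ∣_∣)
open import Data.Fin.Subset.Properties
open import Data.List.Base as List using (List; []; _∷_; _++_; allFin; filter; foldl; length)
import Data.List.Membership.Propositional as List
open import Data.List.Membership.Propositional.Properties
  using (∈-allFin; ∈-∃++; ∈-++⁺ˡ; ∈-++⁺ʳ; ∈-++⁻; ∈-filter⁺; ∈-filter⁻; ∈-map⁺)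
open import Data.List.Properties using (length-++)
open import Data.List.Relation.Unary.AllPairs using (_∷_)
open import Data.List.Relation.Unary.Any using (here; there)
open import Data.List.Relation.Unary.Unique.Propositional using (Unique)
open import Data.List.Relation.Unary.Unique.Propositional.Properties
  using (allFin⁺; filter⁺; Unique[x∷xs]⇒x∉xs)
open import Data.Nat.Base as ℕ using (zero; suc; _+_; _∸_; z≤n; s≤s)
import Data.Nat.Properties as ℕ
open import Data.Product.Base using (Σ; _,_; proj₁; proj₂)
open import Data.Sum.Base using (_⊎_; inj₁; inj₂)
open import Data.Vec.Base as Vec using ([]; _∷_; lookup; tabulate; here; there)
open import Data.Vec.Properties using (lookup⇒[]=; []=⇒lookup; lookup∘tabulate; tabulate-cong)
open import Data.Vec.Relation.Unary.All using (All; []; _∷_; universal)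
open import Data.Vec.Relation.Unary.All.Properties using (lookup⁻) renaming (lookup⁺ to infixl 9 _!_)
open import Function.Base using (_∘_; id; const)
open import Level using (0ℓ)
open import Relation.Binary.PropositionalEquality
  using (_≡_; _≢_; refl; sym; trans; cong; cong₂; cong-app; subst; subst₂; module ≡-Reasoning)
open import Relation.Nullary.Decidable
  using (Dec; yes; no; does; map′; _×-dec_; _→-dec_; dec-true; decidable-stable)
open import Relation.Nullary.Negation using (¬_; contradiction)
open import Relation.Unary using (Pred; Decidable)

open import Algebra.Properties.CommutativeMonoid.Sum ℕ.+-0-commutativeMonoid
  using (sum; ∑-distrib-+; sum-cong-≗; sum-replicate-zero)

open Partition

private
  variable
    m n n′ : ℕ
    ks     : Vec ℕ m
    P      : ℕ → Set

-- Replacing one coordinate of a tuple.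

_[_]≔_ : All P ks → ∀ i → P (lookup ks i) → All P ks
(_ ∷ x) [ zero  ]≔ a = a ∷ x
(b ∷ x) [ suc i ]≔ a = b ∷ x [ i ]≔ a

infixl 9 _[_]≔_

!-ext : {x y : All P ks} → (∀ l → x ! l ≡ y ! l) → x ≡ y
!-ext {x = []}    {[]}    eq = refl
!-ext {x = a ∷ x} {b ∷ y} eq = cong₂ _∷_ (eq zero) (!-ext (eq ∘ suc))

!∘lookup⁻ : (g : ∀ i → P (lookup ks i)) → ∀ i → lookup⁻ {P = P} {xs = ks} g ! i ≡ g i
!∘lookup⁻ {ks = _ ∷ _} g zero    = refl
!∘lookup⁻ {P = P} {ks = _ ∷ ks} g (suc i) = !∘lookup⁻ {P = P} {ks = ks} (g ∘ suc) i

[]≔-updates : (x : All P ks) → ∀ i a → x [ i ]≔ a ! i ≡ a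
[]≔-updates (_ ∷ x) zero    a = refl
[]≔-updates (_ ∷ x) (suc i) a = []≔-updates x i a

[]≔-minimal : (x : All P ks) → ∀ {i l} a → l ≢ i → x [ i ]≔ a ! l ≡ x ! l
[]≔-minimal (_ ∷ x) {zero}  {zero}  a l≢i = contradiction refl l≢i
[]≔-minimal (_ ∷ x) {zero}  {suc l} a l≢i = refl
[]≔-minimal (_ ∷ x) {suc i} {zero}  a l≢i = refl
[]≔-minimal (_ ∷ x) {suc i} {suc l} a l≢i = []≔-minimal x a (l≢i ∘ cong suc)

-- The predicate depends on the coordinate, so that this one case split serves membership in boxes,
-- agreement under maps and equality of tuples alike.
[]≔-elim : (Q : ∀ l → P (lookup ks l) → Set) (x : All P ks) → ∀ {i} a →
           Q i a → (∀ l → l ≢ i → Q l (x ! l)) → ∀ l → Q l (x [ i ]≔ a ! l)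
[]≔-elim Q x {i} a q r l with l ≟ i
... | yes refl = subst (Q l) (sym ([]≔-updates x l a)) q
... | no  l≢i  = subst (Q l) (sym ([]≔-minimal x a l≢i)) (r l l≢i)

[]≔-at : (Q : ∀ l → P (lookup ks l) → Set) (x : All P ks) → ∀ {i a} →
         (∀ l → Q l (x [ i ]≔ a ! l)) → Q i a
[]≔-at Q x {i} {a} q = subst (Q i) ([]≔-updates x i a) (q i)

[]≔-off : (Q : ∀ l → P (lookup ks l) → Set) (x : All P ks) → ∀ {i a} →
          (∀ l → Q l (x [ i ]≔ a ! l)) → ∀ l → l ≢ i → Q l (x ! l)
[]≔-off Q x {i} {a} q l l≢i = subst (Q l) ([]≔-minimal x a l≢i) (q l)

[]≔-ext : (x y : All P ks) → ∀ {i} a → (∀ l → l ≢ i → x ! l ≡ y ! l) → x [ i ]≔ a ≡ y [ i ]≔ a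
[]≔-ext x y {i} a eq = !-ext ([]≔-elim (λ l b → b ≡ y [ i ]≔ a ! l) x a
  (sym ([]≔-updates y i a)) (λ l l≢i → trans (eq l l≢i) (sym ([]≔-minimal y a l≢i))))

[]≔-lookup : (x : All P ks) → ∀ i → x [ i ]≔ (x ! i) ≡ x
[]≔-lookup x i = !-ext ([]≔-elim (λ l b → b ≡ x ! l) x (x ! i) refl (λ _ _ → refl))

[]≔-idempotent : (x : All P ks) → ∀ i a b → x [ i ]≔ a [ i ]≔ b ≡ x [ i ]≔ b
[]≔-idempotent x i a b = []≔-ext (x [ i ]≔ a) x b (λ l → []≔-minimal x a)

[]≔-commutes : (x : All P ks) → ∀ {i j} a b → i ≢ j → x [ i ]≔ a [ j ]≔ b ≡ x [ j ]≔ b [ i ]≔ a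
[]≔-commutes {P = P} x {i} {j} a b i≢j = !-ext ([]≔-elim {P = P} (λ l c → c ≡ x [ j ]≔ b [ i ]≔ a ! l) (x [ i ]≔ a) b
  (sym (trans ([]≔-minimal (x [ j ]≔ b) a (i≢j ∘ sym)) ([]≔-updates x j b)))
  ([]≔-elim (λ l c → l ≢ j → c ≡ x [ j ]≔ b [ i ]≔ a ! l) x a
    (λ _ → sym ([]≔-updates (x [ j ]≔ b) i a))
    (λ l l≢i l≢j → sym (trans ([]≔-minimal (x [ j ]≔ b) a l≢i) ([]≔-minimal x b l≢j)))))

[]≔ᵇ-∈ : ∀ (x : Point ks) (B : Box ks) {i A} → x ! i ∈ A → (∀ l → l ≢ i → x ! l ∈ B ! l) →
         x ∈ᵇ B [ i ]≔ A
[]≔ᵇ-∈ x B {A = A} = []≔-elim (λ l C → x ! l ∈ C) B A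

∈ᵇ-at : ∀ (x : Point ks) (B : Box ks) {i A} → x ∈ᵇ B [ i ]≔ A → x ! i ∈ A
∈ᵇ-at x B = []≔-at (λ l C → x ! l ∈ C) B

∈ᵇ-off : ∀ (x : Point ks) (B : Box ks) {i A} → x ∈ᵇ B [ i ]≔ A → ∀ l → l ≢ i → x ! l ∈ B ! l
∈ᵇ-off x B = []≔-off (λ l C → x ! l ∈ C) B

[]≔-∈ : ∀ (x : Point ks) (B : Box ks) {i a} → (∀ l → l ≢ i → x ! l ∈ B ! l) → a ∈ B ! i → x [ i ]≔ a ∈ᵇ B
[]≔-∈ x B {a = a} off a∈ = []≔-elim (λ l b → b ∈ B ! l) x a a∈ off

[]≔-∈ᵇ : ∀ (x : Point ks) (B : Box ks) {i a A} → (∀ l → l ≢ i → x ! l ∈ B ! l) → a ∈ A →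
         x [ i ]≔ a ∈ᵇ B [ i ]≔ A
[]≔-∈ᵇ x B {i} {a} {A} off a∈ = []≔ᵇ-∈ (x [ i ]≔ a) B
  (subst (_∈ A) (sym ([]≔-updates x i a)) a∈)
  (λ l l≢i → subst (_∈ B ! l) (sym ([]≔-minimal x a l≢i)) (off l l≢i))

⟦_⟧ : {P : Pred (Fin n) 0ℓ} → Decidable P → Subset n
⟦ P? ⟧ = tabulate (does ∘ P?)

∈⟦⟧⁺ : {P : Pred (Fin n) 0ℓ} (P? : Decidable P) → ∀ {a} → P a → a ∈ ⟦ P? ⟧
∈⟦⟧⁺ P? {a} p = lookup⇒[]= a _ (trans (lookup∘tabulate (does ∘ P?) a) (dec-true (P? a) p))

∈⟦⟧⁻ : {P : Pred (Fin n) 0ℓ} (P? : Decidable P) → ∀ {a} → a ∈ ⟦ P? ⟧ → P a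
∈⟦⟧⁻ P? {a} a∈ with P? a | trans (sym (lookup∘tabulate (does ∘ P?) a)) ([]=⇒lookup a∈)
... | yes p | _ = p

-- Shattering inside a subproduct.

-- A box D and maps ρᵢ preserving its sides encode a partition of each Dᵢ,
-- namely into the fibres of ρᵢ.
Maps : Vec ℕ m → Set
Maps = All (λ k → Fin (suc k) → Fin (suc k))

apply : Maps ks → Point ks → Point ks
apply w x = lookup⁻ (λ i → (w ! i) (x ! i))

apply-! : (w : Maps ks) (x : Point ks) → ∀ i → apply w x ! i ≡ (w ! i) (x ! i)
apply-! {ks = ks} w x = !∘lookup⁻ {ks = ks} (λ i → (w ! i) (x ! i))

Preserves : Box ks → Maps ks → Set
Preserves D ρ = ∀ i a → a ∈ D ! i → (ρ ! i) a ∈ D ! i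

ShatteredOn : Box ks → Maps ks → Region ks → Set
ShatteredOn D ρ S =
  ∀ x → x ∈ᵇ D → ∃ λ y → y ∈ʳ S × y ∈ᵇ D × (∀ i → (ρ ! i) (y ! i) ≡ (ρ ! i) (x ! i))

-- Here `w` chooses a representative for each element instead of each block. Elements of one block
-- may get different representatives: the images of the sides still form a box in `S` that meets
-- every block, and so contains a copy.
StronglyShatteredOn : Box ks → Maps ks → Region ks → Set
StronglyShatteredOn {ks = ks} D ρ S = Σ (Maps ks) λ w →
  (∀ i a → a ∈ D ! i → (w ! i) a ∈ D ! i × (ρ ! i) ((w ! i) a) ≡ (ρ ! i) a) ×
  (∀ x → x ∈ᵇ D → apply w x ∈ʳ S)

∃point? : {P : Pred (Point ks) 0ℓ} → Decidable P → Dec (∃ P)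
∃point? {ks = []}     P? = map′ (λ p → [] , p) (λ { ([] , p) → p }) (P? [])
∃point? {ks = k ∷ ks} P? =
  map′ (λ { (a , x , p) → a ∷ x , p }) (λ { (a ∷ x , p) → a , x , p })
       (Fin.any? λ a → ∃point? λ x → P? (a ∷ x))

shatteredOn? : (D : Box ks) (ρ : Maps ks) (S : Region ks) → Dec (ShatteredOn D ρ S)
shatteredOn? D ρ S = ∀point? λ x → (x ∈ᵇ? D) →-dec
  ∃point? λ y → T? (S y) ×-dec (y ∈ᵇ? D) ×-dec Fin.all? λ i → (ρ ! i) (y ! i) ≟ (ρ ! i) (x ! i)

-- One step from a subproduct towards `U`: side `i` becomes the whole factor, and `ρ` is extended so
-- that shattering passes to the larger box while strong shattering passes back. The element `d`
-- names a block of the old side into which new elements can be put.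
module Extend {m : ℕ} {ks : Vec ℕ m} (D : Box ks) (ρ : Maps ks) (S : Region ks) (i : Fin m)
              {d : Fin (suc (lookup ks i))} (d∈ : d ∈ D ! i) (ρ-pres : Preserves D ρ) where

  D′ : Box ks
  D′ = D [ i ]≔ ⊤

  -- A point a outside the i-th side becomes a singleton block if the fibre of
  -- S over a shatters the partition on its own, and joins the block of d
  -- otherwise.  In the latter case a cannot represent that block in a copy.
  r : Fin _ → Fin _
  r a with a ∈? D ! i | shatteredOn? (D [ i ]≔ ⁅ a ⁆) ρ S
  ... | yes _ | _     = (ρ ! i) a
  ... | no  _ | yes _ = a
  ... | no  _ | no  _ = (ρ ! i) d

  r-∈ : ∀ {a} → a ∈ D ! i → r a ≡ (ρ ! i) a
  r-∈ {a} a∈ with a ∈? D ! i | shatteredOn? (D [ i ]≔ ⁅ a ⁆) ρ S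
  ... | yes _  | _ = refl
  ... | no  a∉ | _ = contradiction a∈ a∉

  r-good : ∀ {a} → a ∉ D ! i → ShatteredOn (D [ i ]≔ ⁅ a ⁆) ρ S → r a ≡ a
  r-good {a} a∉ sh with a ∈? D ! i | shatteredOn? (D [ i ]≔ ⁅ a ⁆) ρ S
  ... | yes a∈ | _     = contradiction a∈ a∉
  ... | no  _  | yes _ = refl
  ... | no  _  | no ¬sh = contradiction sh ¬sh

  r-bad : ∀ {a} → a ∉ D ! i → ¬ ShatteredOn (D [ i ]≔ ⁅ a ⁆) ρ S → r a ≡ (ρ ! i) d
  r-bad {a} a∉ ¬sh with a ∈? D ! i | shatteredOn? (D [ i ]≔ ⁅ a ⁆) ρ S
  ... | yes a∈ | _      = contradiction a∈ a∉
  ... | no  _  | yes sh = contradiction sh ¬sh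
  ... | no  _  | no _   = refl

  ρ′ : Maps ks
  ρ′ = ρ [ i ]≔ r

  preserves : Preserves D′ ρ′
  preserves l a a∈ with l ≟ i
  ... | yes refl = subst ((ρ′ ! l) a ∈_) (sym ([]≔-updates D l ⊤)) ∈⊤
  ... | no  l≢i  rewrite []≔-minimal D ⊤ l≢i | []≔-minimal ρ r l≢i = ρ-pres l a a∈

  module _ (sh : ShatteredOn D ρ S) where

    -- If coordinate `i` shares its block with an element of the old side, moving it to that element
    -- reduces the claim to `sh`. Otherwise it is a singleton block, and these were created only
    -- over fibres that shatter by themselves.
    shattered : ShatteredOn D′ ρ′ S
    shattered x x∈D′ = case (x ! i ∈? D ! i) (shatteredOn? (D [ i ]≔ ⁅ x ! i ⁆) ρ S)
      where
      off : ∀ l → l ≢ i → x ! l ∈ D ! l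
      off = ∈ᵇ-off x D x∈D′
      Goal : Set
      Goal = ∃ λ y → y ∈ʳ S × y ∈ᵇ D′ × (∀ l → (ρ′ ! l) (y ! l) ≡ (ρ′ ! l) (x ! l))
      build : ∀ y → y ∈ʳ S → (∀ l → l ≢ i → y ! l ∈ D ! l) → r (y ! i) ≡ r (x ! i) →
              (∀ l → l ≢ i → (ρ ! l) (y ! l) ≡ (ρ ! l) (x ! l)) → Goal
      build y y∈S y∈ eq eqs = y , y∈S , []≔ᵇ-∈ y D ∈⊤ y∈ ,
        []≔-elim (λ l g → g (y ! l) ≡ g (x ! l)) ρ r eq eqs
      viaD : ∀ {a} → a ∈ D ! i → r (x ! i) ≡ (ρ ! i) a → Goal
      viaD {a} a∈ rx with sh (x [ i ]≔ a) ([]≔-∈ x D off a∈)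
      ... | y , y∈S , y∈ , eqs = build y y∈S (λ l _ → y∈ l)
        (trans (r-∈ (y∈ i)) (trans (eqs i) (trans (cong (ρ ! i) ([]≔-updates x i a)) (sym rx))))
        (λ l l≢i → trans (eqs l) (cong (ρ ! l) ([]≔-minimal x a l≢i)))
      case : Dec (x ! i ∈ D ! i) → Dec (ShatteredOn (D [ i ]≔ ⁅ x ! i ⁆) ρ S) → Goal
      case (yes x∈) _ = viaD x∈ (r-∈ x∈)
      case (no x∉) (no ¬g) = viaD d∈ (r-bad x∉ ¬g)
      case (no x∉) (yes g)
        with g x ([]≔ᵇ-∈ x D (x∈⁅x⁆ _) off)
      ... | y , y∈S , y∈ , eqs = build y y∈S (∈ᵇ-off y D y∈)
        (cong r (x∈⁅y⁆⇒x≡y _ (∈ᵇ-at y D y∈))) (λ l _ → eqs l)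

  module _ (str : StronglyShatteredOn D′ ρ′ S) where

    w   = proj₁ str
    w∈  = proj₁ (proj₂ str)
    w∈S = proj₂ (proj₂ str)

    r-w : ∀ a → r ((w ! i) a) ≡ r a
    r-w a = []≔-at (λ l g → ∀ b → b ∈ D′ ! l → g ((w ! l) b) ≡ g b) ρ
              (λ l b b∈ → proj₂ (w∈ l b b∈)) a
              (subst (a ∈_) (sym ([]≔-updates D i ⊤)) ∈⊤)

    w-off : ∀ l → l ≢ i → ∀ b → b ∈ D ! l → (w ! l) b ∈ D ! l × (ρ ! l) ((w ! l) b) ≡ (ρ ! l) b
    w-off l l≢i b b∈ with w∈ l b
    ... | p rewrite []≔-minimal D ⊤ l≢i | []≔-minimal ρ r l≢i = p b∈

    -- Suppose `w` sent `a` to some e outside the old side. The copy gives points of `S` with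
    -- coordinate `i` equal to e in all the blocks, so the fibre over e is shattered and `r` fixes
    -- e. But `r` takes the same value at e as at `a`, and that value lies in the old side because
    -- `ρ` preserves it.
    w-in : ∀ {a} → a ∈ D ! i → (w ! i) a ∈ D ! i
    w-in {a} a∈ = decidable-stable (_ ∈? _) λ e∉ →
      e∉ (subst (_∈ D ! i)
           (trans (sym (r-∈ a∈)) (trans (sym (r-w a)) (r-good e∉ good)))
           (ρ-pres i a a∈))
      where
      good : ShatteredOn (D [ i ]≔ ⁅ (w ! i) a ⁆) ρ S
      good x x∈ = y , w∈S (x [ i ]≔ a) ([]≔-∈ᵇ x D off ∈⊤) , y∈ , eqs
        where
        off : ∀ l → l ≢ i → x ! l ∈ D ! l
        off = ∈ᵇ-off x D x∈
        y : Point _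
        -- Coordinate `i` is set to `a` so that `w` carries it to the value whose fibre is examined.
        y = apply w (x [ i ]≔ a)
        y! : ∀ l → y ! l ≡ (w ! l) (x [ i ]≔ a ! l)
        y! = apply-! w (x [ i ]≔ a)
        y!-off : ∀ l → l ≢ i → y ! l ≡ (w ! l) (x ! l)
        y!-off l l≢i = trans (y! l) (cong (w ! l) ([]≔-minimal x a l≢i))
        y!i : y ! i ≡ (w ! i) a
        y!i = trans (y! i) (cong (w ! i) ([]≔-updates x i a))
        y∈ : y ∈ᵇ D [ i ]≔ ⁅ (w ! i) a ⁆
        y∈ = []≔ᵇ-∈ y D
          (subst (_∈ ⁅ (w ! i) a ⁆) (sym y!i) (x∈⁅x⁆ _))
          (λ l l≢i → subst (_∈ D ! l) (sym (y!-off l l≢i)) (proj₁ (w-off l l≢i _ (off l l≢i))))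
        eqs : ∀ l → (ρ ! l) (y ! l) ≡ (ρ ! l) (x ! l)
        eqs l with l ≟ i
        ... | yes refl = cong (ρ ! l) (trans y!i
                           (sym (x∈⁅y⁆⇒x≡y _ (∈ᵇ-at x D x∈))))
        ... | no  l≢i  = trans (cong (ρ ! l) (y!-off l l≢i)) (proj₂ (w-off l l≢i _ (off l l≢i)))

    strongly : StronglyShatteredOn D ρ S
    strongly = w , all , λ x x∈ → w∈S x ([]≔ᵇ-∈ x D ∈⊤ λ l _ → x∈ l)
      where
      all : ∀ l a → a ∈ D ! l → (w ! l) a ∈ D ! l × (ρ ! l) ((w ! l) a) ≡ (ρ ! l) a
      all l a a∈ with l ≟ i
      ... | yes refl = w-in a∈ , trans (sym (r-∈ (w-in a∈))) (trans (r-w a) (r-∈ a∈))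
      ... | no  l≢i  = w-off l l≢i a a∈

-- Kernels of maps as partitions.

-- Blocks of a `Partition` are nonempty, whereas `g` may miss values. So `class` renumbers the image
-- of `g` without gaps.
record Classes {A : Set} (g : Fin n → A) : Set where
  field
    number     : ℕ
    class      : Fin n → Fin number
    surjective : ∀ b → ∃ λ a → class a ≡ b
    sound      : ∀ {a a′} → class a ≡ class a′ → g a ≡ g a′
    complete   : ∀ {a a′} → g a ≡ g a′ → class a ≡ class a′

classes : (g : Fin n → Fin m) → Classes g
classes {zero}  g = record
  { number = 0 ; class = λ () ; surjective = λ () ; sound = λ { {()} } ; complete = λ { {()} } }
classes {suc n} g with Fin.any? (λ a → g (suc a) ≟ g zero)
... | yes (a₀ , eq) = record
  { number = number ; class = class′ ; surjective = λ b → let a , e = surjective b in suc a , e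
  ; sound = λ { {zero} {zero} _ → refl ; {zero} {suc _} e → trans (sym eq) (sound e)
              ; {suc _} {zero} e → trans (sound e) eq ; {suc _} {suc _} e → sound e }
  ; complete = λ { {zero} {zero} _ → refl ; {zero} {suc _} e → complete (trans eq e)
                 ; {suc _} {zero} e → complete (trans e (sym eq)) ; {suc _} {suc _} e → complete e } }
  where
  open Classes (classes (g ∘ suc))
  class′ : Fin (suc n) → Fin number
  class′ zero    = class a₀
  class′ (suc a) = class a
... | no ∄ = record
  { number = suc number ; class = class′
  ; surjective = λ { zero → zero , refl ; (suc b) → let a , e = surjective b in suc a , cong suc e }
  ; sound = λ { {zero} {zero} _ → refl ; {suc _} {suc _} e → sound (suc-injective e) }
  ; complete = λ { {zero} {zero} _ → refl ; {zero} {suc a} e → contradiction (a , sym e) ∄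
                 ; {suc a} {zero} e → contradiction (a , e) ∄ ; {suc _} {suc _} e → cong suc (complete e) } }
  where
  open Classes (classes (g ∘ suc))
  class′ : Fin (suc n) → Fin (suc number)
  class′ zero    = zero
  class′ (suc a) = suc (class a)

kernel : (Fin n → Fin m) → Partition n
kernel g = record
  { size     = number
  ; block    = λ b → ⟦ (λ a → class a ≟ b) ⟧
  ; nonempty = λ b → let a , e = surjective b in a , ∈⟦⟧⁺ (λ a → class a ≟ b) e
  ; unique   = λ a → class a , ∈⟦⟧⁺ (λ a′ → class a′ ≟ class a) refl , ∈⟦⟧⁻ (λ a → class a ≟ _)
  }
  where open Classes (classes g)

-- Stated for an arbitrary `α`, because the components of a tuple built by `lookup⁻` equal the
-- kernels only propositionally.
IsKernel : Partition n → (Fin n → Fin m) → Set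
IsKernel α g = ∀ {b a a′} → a ∈ block α b → (a′ ∈ block α b → g a ≡ g a′) × (g a ≡ g a′ → a′ ∈ block α b)

kernel-isKernel : (g : Fin n → Fin m) → IsKernel (kernel g) g
kernel-isKernel g {b} {a} {a′} a∈ =
  (λ a′∈ → sound (trans (∈⟦⟧⁻ c? a∈) (sym (∈⟦⟧⁻ c? a′∈)))) ,
  (λ eq → ∈⟦⟧⁺ c? (trans (complete (sym eq)) (∈⟦⟧⁻ c? a∈)))
  where
  open Classes (classes g)
  c? = λ a → class a ≟ b

-- Ampleness passes to subproducts.

∈-blockOf : (α : Partition n) → ∀ a → a ∈ block α (blockOf α a)
∈-blockOf α a = proj₁ (proj₂ (unique α a))

-- When `D` is all of `U`, the kernels of the maps form a generalized partition. A copy `W` of its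
-- minor-subproduct yields `w`: each element goes to the element of `W` in its block.
ample⇒full : {S : Region ks} → Ample S → (D : Box ks) (ρ : Maps ks) → (∀ x → x ∈ᵇ D) →
             ShatteredOn D ρ S → StronglyShatteredOn D ρ S
ample⇒full {ks = ks} {S} ample D ρ full sh = w , w-ok , w∈S
  where
  Λ : GenPartition ks
  Λ = lookup⁻ (kernel ∘ (ρ !_))
  ker : ∀ l → IsKernel (Λ ! l) (ρ ! l)
  ker l = subst (λ α → IsKernel α (ρ ! l)) (sym (!∘lookup⁻ {ks = ks} (kernel ∘ (ρ !_)) l))
            (kernel-isKernel (ρ ! l))
  shattered : Shattered Λ S
  shattered c = y , (λ l → proj₂ (ker l (x∈ l)) (sym (ρy l))) , y∈S
    where
    rep : ∀ l → Fin (suc (lookup ks l))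
    rep l = proj₁ (nonempty (Λ ! l) (c l))
    x : Point ks
    x = lookup⁻ rep
    x∈ : ∀ l → x ! l ∈ block (Λ ! l) (c l)
    x∈ l = subst (_∈ block (Λ ! l) (c l)) (sym (!∘lookup⁻ {ks = ks} rep l)) (proj₂ (nonempty (Λ ! l) (c l)))
    sh-x = sh x (full x)
    y    = proj₁ sh-x
    y∈S  = proj₁ (proj₂ sh-x)
    ρy   = proj₂ (proj₂ (proj₂ sh-x))
  str : StronglyShattered Λ S
  str = ample Λ shattered
  W     = proj₁ str
  copy  = proj₁ (proj₂ str)
  W⊆S   = proj₂ (proj₂ str)
  pick : ∀ l → Fin (suc (lookup ks l)) → Fin (suc (lookup ks l))
  pick l a = proj₁ (copy l (blockOf (Λ ! l) a))
  w : Maps ks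
  w = lookup⁻ pick
  w! : ∀ l a → (w ! l) a ≡ pick l a
  w! l a = cong-app (!∘lookup⁻ {P = λ k → Fin (suc k) → Fin (suc k)} {ks = ks} pick l) a
  ∈full : ∀ l a → a ∈ D ! l
  ∈full l a = []≔-at (λ l b → b ∈ D ! l) (origin {ks = ks}) (full (origin [ l ]≔ a))
  w-ok : ∀ l a → a ∈ D ! l → (w ! l) a ∈ D ! l × (ρ ! l) ((w ! l) a) ≡ (ρ ! l) a
  w-ok l a _ = ∈full l _ , trans (cong (ρ ! l) (w! l a))
    (proj₁ (ker l (proj₂ (proj₁ (proj₂ (copy l _))))) (∈-blockOf (Λ ! l) a))
  w∈S : ∀ x → x ∈ᵇ D → apply w x ∈ʳ S
  w∈S x _ = W⊆S _ λ l → subst (_∈ W ! l) (sym (trans (apply-! w x l) (w! l (x ! l))))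
    (proj₁ (proj₁ (proj₂ (copy l _))))

-- Ampleness passes to subproducts; the coordinates not yet full are listed in is.
ample⇒on : {S : Region ks} → Ample S → ∀ is (D : Box ks) (ρ : Maps ks) →
           (∀ l → l List.∈ is ⊎ (∀ a → a ∈ D ! l)) → IsBox D → Preserves D ρ →
           ShatteredOn D ρ S → StronglyShatteredOn D ρ S
ample⇒on ample [] D ρ full box pres sh = ample⇒full ample D ρ (λ x l → all l (full l) (x ! l)) sh
  where
  all : ∀ l → l List.∈ [] ⊎ (∀ a → a ∈ D ! l) → ∀ a → a ∈ D ! l
  all l (inj₂ p) = p
ample⇒on {ks = ks} {S} ample (i ∷ is) D ρ full box pres sh =
  E.strongly (ample⇒on ample is E.D′ E.ρ′ full′ box′ E.preserves (E.shattered sh))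
  where
  module E = Extend D ρ S i (proj₂ (box i)) pres
  box′ : IsBox E.D′
  box′ = []≔-elim (λ _ → Nonempty) D ⊤ (zero , ∈⊤) (λ l _ → box l)
  full′ : ∀ l → l List.∈ is ⊎ (∀ a → a ∈ E.D′ ! l)
  full′ = []≔-elim (λ l B → l List.∈ is ⊎ (∀ a → a ∈ B)) D ⊤ (inj₂ λ _ → ∈⊤) λ l l≢i → go l l≢i (full l)
    where
    go : ∀ l → l ≢ i → l List.∈ (i ∷ is) ⊎ (∀ a → a ∈ D ! l) → l List.∈ is ⊎ (∀ a → a ∈ D ! l)
    go l l≢i (inj₁ (here l≡i)) = contradiction l≡i l≢i
    go l l≢i (inj₁ (there l∈)) = inj₁ l∈
    go l l≢i (inj₂ f) = inj₂ f

-- Ampleness on D for the partition into the single block Dⱼ in coordinate j and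
-- singletons elsewhere.
ample⇒common : {S : Region ks} → Ample S → ∀ {D} → IsBox D → ∀ j →
               (∀ x → x ∈ᵇ D → ∃ λ a → a ∈ D ! j × x [ j ]≔ a ∈ʳ S) →
               ∃ λ a → a ∈ D ! j × (∀ x → x ∈ᵇ D → x [ j ]≔ a ∈ʳ S)
ample⇒common {ks = ks} {S} ample {D} box j hit =
  c , proj₁ (w-ok j a₀ a₀∈) , λ x x∈ → subst (_∈ʳ S) (eq x x∈) (w∈S (x [ j ]≔ a₀) (upd x x∈ a₀∈))
  where
  a₀  = proj₁ (box j)
  a₀∈ = proj₂ (box j)
  ids : Maps ks
  ids = universal (λ _ → id) ks
  ids! : ∀ {m} {ks : Vec ℕ m} l {a} → (universal {P = λ k → Fin (suc k) → Fin (suc k)} (λ _ → id) ks ! l) a ≡ a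
  ids! {ks = _ ∷ _} zero    = refl
  ids! {ks = _ ∷ ks} (suc l) = ids! {ks = ks} l
  ρ : Maps ks
  ρ = ids [ j ]≔ const a₀
  pres : Preserves D ρ
  pres = []≔-elim (λ l g → ∀ a → a ∈ D ! l → g a ∈ D ! l) ids (const a₀)
    (λ _ _ → a₀∈) (λ l _ a a∈ → subst (_∈ D ! l) (sym (ids! {ks = ks} l)) a∈)
  upd : ∀ x {a} → x ∈ᵇ D → a ∈ D ! j → x [ j ]≔ a ∈ᵇ D
  upd x x∈ = []≔-∈ x D (λ l _ → x∈ l)
  sh : ShatteredOn D ρ S
  sh x x∈ with hit x x∈
  ... | a , a∈ , xa∈S = x [ j ]≔ a , xa∈S , upd x x∈ a∈ ,
    []≔-elim (λ l g → g (x [ j ]≔ a ! l) ≡ g (x ! l)) ids (const a₀) refl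
      (λ l l≢j → cong (ids ! l) ([]≔-minimal x a l≢j))
  str : StronglyShatteredOn D ρ S
  str = ample⇒on ample (allFin _) D ρ (λ l → inj₁ (∈-allFin l)) box pres sh
  w    = proj₁ str
  w-ok = proj₁ (proj₂ str)
  w∈S  = proj₂ (proj₂ str)
  -- Off `j` the blocks are singletons, which forces `w` to fix those coordinates. Points whose
  -- coordinate `j` is `a₀` are therefore changed by `w` in that coordinate only, and all receive
  -- the same value there.
  c = (w ! j) a₀
  w-fix : ∀ l → l ≢ j → ∀ {a} → a ∈ D ! l → (w ! l) a ≡ a
  w-fix l l≢j {a} a∈ = trans (sym (ids! {ks = ks} l)) (trans
    ([]≔-off (λ l g → ∀ a → a ∈ D ! l → g ((w ! l) a) ≡ g a) ids
      (λ l a a∈ → proj₂ (w-ok l a a∈)) l l≢j a a∈) (ids! {ks = ks} l))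
  eq : ∀ x → x ∈ᵇ D → apply w (x [ j ]≔ a₀) ≡ x [ j ]≔ c
  eq x x∈ = !-ext λ l → trans (apply-! w (x [ j ]≔ a₀) l) (go l)
    where
    go : ∀ l → (w ! l) (x [ j ]≔ a₀ ! l) ≡ x [ j ]≔ c ! l
    go l with l ≟ j
    ... | yes refl = trans (cong (w ! l) ([]≔-updates x l a₀)) (sym ([]≔-updates x l c))
    ... | no l≢j   = trans (cong (w ! l) ([]≔-minimal x a₀ l≢j)) (trans (w-fix l l≢j (x∈ l)) (sym ([]≔-minimal x c l≢j)))

-- Counting by injections.

-- Deleting the image of the head from `ys` leaves a list that still receives the images of the
-- tail, since by injectivity and uniqueness no other element has that image.
length-injection : {A B : Set} {xs : List A} {ys : List B} (g : A → B) → Unique xs →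
                   (∀ {x} → x List.∈ xs → g x List.∈ ys) →
                   (∀ {x y} → x List.∈ xs → y List.∈ xs → g x ≡ g y → x ≡ y) →
                   length xs ≤ length ys
length-injection {xs = []} g uniq into inj = z≤n
length-injection {xs = x ∷ xs} g uniq@(_ ∷ uniq′) into inj with ∈-∃++ (into (here refl))
... | as , bs , refl = begin
  suc (length xs)            ≤⟨ s≤s (length-injection g uniq′ into′ λ y∈ z∈ → inj (there y∈) (there z∈)) ⟩
  suc (length (as ++ bs))    ≡⟨ cong suc (length-++ as) ⟩
  suc (length as + length bs) ≡⟨ ℕ.+-suc (length as) (length bs) ⟨
  length as + suc (length bs) ≡⟨ length-++ as ⟨
  length (as ++ g x ∷ bs)    ∎
  where
  open ℕ.≤-Reasoning
  into′ : ∀ {y} → y List.∈ xs → g y List.∈ as ++ bs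
  into′ {y} y∈ with ∈-++⁻ as (into (there y∈))
  ... | inj₁ p = ∈-++⁺ˡ p
  ... | inj₂ (there p) = ∈-++⁺ʳ as p
  ... | inj₂ (here eq) = contradiction (subst (List._∈ xs) (inj (there y∈) (here refl) eq) y∈) (Unique[x∷xs]⇒x∉xs uniq)

filter-injection : {A B : Set} {P : Pred A 0ℓ} {Q : Pred B 0ℓ} (P? : Decidable P) (Q? : Decidable Q)
                   {xs : List A} {ys : List B} (g : A → B) → Unique xs → (∀ y → y List.∈ ys) →
                   (∀ x → P x → Q (g x)) → (∀ {x y} → P x → P y → g x ≡ g y → x ≡ y) →
                   length (filter P? xs) ≤ length (filter Q? ys)
filter-injection P? Q? {xs} g uniq all into inj = length-injection g (filter⁺ P? uniq)
  (λ x∈ → ∈-filter⁺ Q? (all _) (into _ (proj₂ (∈-filter⁻ P? {xs = xs} x∈))))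
  (λ x∈ y∈ → inj (proj₂ (∈-filter⁻ P? {xs = xs} x∈)) (proj₂ (∈-filter⁻ P? {xs = xs} y∈)))

length-filter-tabulate : {A : Set} {P : Pred A 0ℓ} (P? : Decidable P) (g : Fin n → A) →
                         length (filter P? (List.tabulate g)) ≡ ∣ ⟦ P? ∘ g ⟧ ∣
length-filter-tabulate {zero}  P? g = refl
length-filter-tabulate {suc n} P? g with P? (g zero)
... | yes _ = cong suc (length-filter-tabulate P? (g ∘ suc))
... | no  _ = length-filter-tabulate P? (g ∘ suc)

-- All points with `P` lie on the line through `x` in direction `j`, where taking coordinate `j` and
-- substituting it into `x` are inverse to each other.
count-line : ∀ {P : Pred (Point ks) 0ℓ} (P? : Decidable P) (x : Point ks) j
             {Q : Pred (Fin _) 0ℓ} (Q? : Decidable Q) →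
             (∀ y → P y → x [ j ]≔ (y ! j) ≡ y) →
             (∀ a → (P (x [ j ]≔ a) → Q a) × (Q a → P (x [ j ]≔ a))) →
             count P? ≡ ∣ ⟦ Q? ⟧ ∣
count-line {ks = ks} {P} P? x j {Q} Q? line iff = trans
  (ℕ.≤-antisym
    (filter-injection P? Q? (_! j) (points-unique ks) ∈-allFin
      (λ y p → proj₁ (iff _) (subst P (sym (line y p)) p))
      (λ {y} {z} p q eq → trans (sym (line y p)) (trans (cong (x [ j ]≔_) eq) (line z q))))
    (filter-injection Q? P? (x [ j ]≔_) (allFin⁺ _) points-complete
      (λ a → proj₂ (iff a))
      (λ {a} {b} _ _ eq → trans (sym ([]≔-updates x j a)) (trans (cong (_! j) eq) ([]≔-updates x j b)))))
  (length-filter-tabulate Q? id)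

-- Sizes of subsets, block by block.

∣∷∣ : ∀ s (p : Subset n) → ∣ s ∷ p ∣ ≡ (if s then 1 else 0) + ∣ p ∣
∣∷∣ inside  p = refl
∣∷∣ outside p = refl

sum-mono : ∀ {s} {g h : Fin s → ℕ} → (∀ b → g b ≤ h b) → sum g ≤ sum h
sum-mono {zero}  g≤h = z≤n
sum-mono {suc s} g≤h = ℕ.+-mono-≤ (g≤h zero) (sum-mono (g≤h ∘ suc))

sum-indicator : ∀ {s} (c : Fin s) → sum (λ b → if does (c ≟ b) then 1 else 0) ≡ 1
sum-indicator {suc s} zero    = cong suc (sum-replicate-zero s)
sum-indicator {suc s} (suc c) = sum-indicator c

∣∣-fibres : ∀ {s} (c : Fin n → Fin s) (p : Subset n) →
            ∣ p ∣ ≡ sum (λ b → ∣ p ∩ ⟦ (λ a → c a ≟ b) ⟧ ∣)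
∣∣-fibres {s = s} c [] = sym (sum-replicate-zero s)
∣∣-fibres c (outside ∷ p) = ∣∣-fibres (c ∘ suc) p
∣∣-fibres {s = s} c (inside ∷ p) = begin
  suc ∣ p ∣ ≡⟨ cong₂ _+_ (sym (sum-indicator (c zero))) (∣∣-fibres (c ∘ suc) p) ⟩
  sum ind + sum rest ≡⟨ ∑-distrib-+ ind rest ⟨
  sum (λ b → ind b + rest b) ≡⟨ sum-cong-≗ (λ b → ∣∷∣ (does (c zero ≟ b)) (p ∩ ⟦ (λ a → c (suc a) ≟ b) ⟧)) ⟨
  sum (λ b → ∣ (inside ∷ p) ∩ ⟦ (λ a → c a ≟ b) ⟧ ∣) ∎
  where
  open ≡-Reasoning
  ind rest : Fin s → ℕ
  ind b  = if does (c zero ≟ b) then 1 else 0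
  rest b = ∣ p ∩ ⟦ (λ a → c (suc a) ≟ b) ⟧ ∣

blockOf-unique : (α : Partition n) → ∀ {a b} → a ∈ block α b → blockOf α a ≡ b
blockOf-unique α {a} = proj₂ (proj₂ (unique α a))

block≡fibre : (α : Partition n) → ∀ b → block α b ≡ ⟦ (λ a → blockOf α a ≟ b) ⟧
block≡fibre α b = ⊆-antisym
  (λ a∈ → ∈⟦⟧⁺ c? (blockOf-unique α a∈))
  (λ {a} a∈ → subst (λ b → a ∈ block α b) (∈⟦⟧⁻ c? a∈) (∈-blockOf α a))
  where c? = λ a → blockOf α a ≟ b

-- The blocks are the fibres of `blockOf`, so each size is the sum of its parts over the blocks.
∣∣-blockwise : (α : Partition n) {p q : Subset n} →
               (∀ b → ∣ p ∩ block α b ∣ ≤ ∣ q ∩ block α b ∣) → ∣ p ∣ ≤ ∣ q ∣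
∣∣-blockwise α {p} {q} le = begin
  ∣ p ∣ ≡⟨ ∣∣-fibres (blockOf α) p ⟩
  sum (λ b → ∣ p ∩ ⟦ (λ a → blockOf α a ≟ b) ⟧ ∣) ≤⟨ sum-mono (λ b → subst (λ P → ∣ p ∩ P ∣ ≤ ∣ q ∩ P ∣) (block≡fibre α b) (le b)) ⟩
  sum (λ b → ∣ q ∩ ⟦ (λ a → blockOf α a ≟ b) ⟧ ∣) ≡⟨ ∣∣-fibres (blockOf α) q ⟨
  ∣ q ∣ ∎
  where open ℕ.≤-Reasoning

-- Transport of subsets along increasing bijections.

-- The image of v under the increasing partial bijection from p to q.
transport : Subset n → Subset n′ → Subset n → Subset n′
transport []            q             _       = ⊥
transport (outside ∷ p) q             (_ ∷ v) = transport p q v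
transport (inside ∷ p)  []            _       = []
transport (inside ∷ p)  (outside ∷ q) v       = outside ∷ transport (inside ∷ p) q v
transport (inside ∷ p)  (inside ∷ q)  (s ∷ v) = s ∷ transport p q v

transport-⊆ : (p : Subset n) (q : Subset n′) (v : Subset n) → transport p q v ⊆ q
transport-⊆ []            q             v       = ⊆-min q
transport-⊆ (outside ∷ p) q             (_ ∷ v) = transport-⊆ p q v
transport-⊆ (inside ∷ p)  []            v       = id
transport-⊆ (inside ∷ p)  (outside ∷ q) v       = s⊆s (transport-⊆ (inside ∷ p) q v)
transport-⊆ (inside ∷ p)  (inside ∷ q)  (outside ∷ v) = out⊆ (transport-⊆ p q v)
transport-⊆ (inside ∷ p)  (inside ∷ q)  (inside ∷ v)  = in⊆in (transport-⊆ p q v)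

∣transport∣ : (p : Subset n) (q : Subset n′) {v : Subset n} → v ⊆ p → ∣ p ∣ ≤ ∣ q ∣ →
              ∣ transport p q v ∣ ≡ ∣ v ∣
∣transport∣ {n′ = n′} []  q             {[]}          v⊆p le = ∣⊥∣≡0 n′
∣transport∣ (outside ∷ p) q             {inside ∷ v}  v⊆p le with () ← v⊆p here
∣transport∣ (outside ∷ p) q             {outside ∷ v} v⊆p le = ∣transport∣ p q (drop-∷-⊆ v⊆p) le
∣transport∣ (inside ∷ p)  (outside ∷ q) {v}           v⊆p le = ∣transport∣ (inside ∷ p) q v⊆p le
∣transport∣ (inside ∷ p)  (inside ∷ q)  {outside ∷ v} v⊆p le = ∣transport∣ p q (drop-∷-⊆ v⊆p) (ℕ.s≤s⁻¹ le)
∣transport∣ (inside ∷ p)  (inside ∷ q)  {inside ∷ v}  v⊆p le = cong suc (∣transport∣ p q (drop-∷-⊆ v⊆p) (ℕ.s≤s⁻¹ le))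

transport-injective : (p : Subset n) (q : Subset n′) {v w : Subset n} → v ⊆ p → w ⊆ p → ∣ p ∣ ≤ ∣ q ∣ →
                      transport p q v ≡ transport p q w → v ≡ w
transport-injective []            q {[]}          {[]}          v⊆p w⊆p le eq = refl
transport-injective (outside ∷ p) q {inside ∷ v}  {w}           v⊆p w⊆p le eq with () ← v⊆p here
transport-injective (outside ∷ p) q {outside ∷ v} {inside ∷ w}  v⊆p w⊆p le eq with () ← w⊆p here
transport-injective (outside ∷ p) q {outside ∷ v} {outside ∷ w} v⊆p w⊆p le eq =
  cong (outside ∷_) (transport-injective p q (drop-∷-⊆ v⊆p) (drop-∷-⊆ w⊆p) le eq)
transport-injective (inside ∷ p) (outside ∷ q) v⊆p w⊆p le eq =
  transport-injective (inside ∷ p) q v⊆p w⊆p le (cong Vec.tail eq)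
transport-injective (inside ∷ p) (inside ∷ q) {s ∷ v} {t ∷ w} v⊆p w⊆p le eq =
  cong₂ _∷_ (cong Vec.head eq)
    (transport-injective p q (drop-∷-⊆ v⊆p) (drop-∷-⊆ w⊆p) (ℕ.s≤s⁻¹ le) (cong Vec.tail eq))

x∈p⇒0<∣p∣ : {p : Subset n} {a : Fin n} → a ∈ p → 0 ℕ.< ∣ p ∣
x∈p⇒0<∣p∣ a∈ = ℕ.≤-<-trans z≤n (x∈p⇒∣p-x∣<∣p∣ a∈)

Nonempty-resp-∣∣ : (p : Subset n) (q : Subset n′) → ∣ q ∣ ≡ ∣ p ∣ → Nonempty p → Nonempty q
Nonempty-resp-∣∣ {n′ = n′} p q eq (a , a∈) = decidable-stable (nonempty? q) λ empty →
  ℕ.<⇒≢ (x∈p⇒0<∣p∣ a∈)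
    (trans (sym (∣⊥∣≡0 n′)) (trans (cong ∣_∣ (sym (Empty-unique empty))) eq))

-- Common parts of fibres and the numbers of boxes.

common? : (S : Region ks) (B : Box ks) → ∀ j → Decidable (λ a → ∀ x → x ∈ᵇ B [ j ]≔ ⊤ → x [ j ]≔ a ∈ʳ S)
common? S B j a = ∀point? λ x → (x ∈ᵇ? (B [ j ]≔ ⊤)) →-dec T? (S (x [ j ]≔ a))

-- The intersection of the fibres of `S` over the product of the other sides of `B`. Putting `⊤` in
-- side `j` makes it independent of that side, so all boxes with the same other sides share it.
common : Region ks → Box ks → ∀ j → Subset _
common S B j = ⟦ common? S B j ⟧

common-cong : (S : Region ks) {B C : Box ks} → ∀ j → B [ j ]≔ ⊤ ≡ C [ j ]≔ ⊤ → common S B j ≡ common S C j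
common-cong S j eq = cong (λ D → ⟦ (λ a → ∀point? λ x → (x ∈ᵇ? D) →-dec T? (S (x [ j ]≔ a))) ⟧) eq

⊆common : {S : Region ks} (B : Box ks) → ∀ j → B ⊆ʳ S → B ! j ⊆ common S B j
⊆common {S = S} B j B⊆S a∈ = ∈⟦⟧⁺ (common? S B j) λ x x∈ →
  B⊆S _ (subst (x [ j ]≔ _ ∈ᵇ_) ([]≔-lookup B j) ([]≔-∈ᵇ x B (∈ᵇ-off x B x∈) a∈))

⊆common⁻ : {S : Region ks} (B : Box ks) → ∀ j {A} → A ⊆ common S B j → B [ j ]≔ A ⊆ʳ S
⊆common⁻ {S = S} B j {A} A⊆ x x∈ = subst (_∈ʳ S) ([]≔-lookup x j)
  (∈⟦⟧⁻ (common? S B j) (A⊆ (∈ᵇ-at x B x∈)) x ([]≔ᵇ-∈ x B ∈⊤ (∈ᵇ-off x B x∈)))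

module _ {m : ℕ} {ks : Vec ℕ m} {S S′ : Region ks} (j : Fin m)
         (le : ∀ B → IsBox B → ∣ common S B j ∣ ≤ ∣ common S′ B j ∣) where

  private
    side : Box ks → Subset _
    side B = transport (common S B j) (common S′ B j) (B ! j)

    move : Box ks → Box ks
    move B = B [ j ]≔ side B

    ∣move∣ : ∀ B → IsBox B → B ⊆ʳ S → ∀ l → ∣ move B ! l ∣ ≡ ∣ B ! l ∣
    ∣move∣ B box B⊆S = []≔-elim (λ l C → ∣ C ∣ ≡ ∣ B ! l ∣) B _
      (∣transport∣ (common S B j) (common S′ B j) (⊆common {S = S} B j B⊆S) (le B box)) (λ _ _ → refl)

  -- The injection `move` transports side `j` from one common part to the other and keeps the size
  -- of every side, hence the dimension. It can be undone: the other sides survive, they determine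
  -- both common parts, and transport between these is injective.
  f-mono : ∀ i → f S i ≤ f S′ i
  f-mono i = filter-injection _ _ move (boxes-unique ks) boxes-complete
    (λ { B (box , dim≡ , B⊆S) →
        (λ l → Nonempty-resp-∣∣ (B ! l) (move B ! l) (∣move∣ B box B⊆S l) (box l)) ,
        trans (cong Vec.sum (tabulate-cong λ l → cong (_∸ 1) (∣move∣ B box B⊆S l))) dim≡ ,
        ⊆common⁻ {S = S′} B j (transport-⊆ (common S B j) (common S′ B j) (B ! j)) })
    (λ { {B} {C} (box , _ , B⊆S) (_ , _ , C⊆S) eq → inj B C box B⊆S C⊆S eq })
    where
    inj : ∀ B C → IsBox B → B ⊆ʳ S → C ⊆ʳ S → move B ≡ move C → B ≡ C
    inj B C box B⊆S C⊆S eq = begin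
      B                ≡⟨ []≔-lookup B j ⟨
      B [ j ]≔ (B ! j) ≡⟨ cong (B [ j ]≔_) side≡ ⟩
      B [ j ]≔ (C ! j) ≡⟨ reset B (C ! j) ⟨
      B [ j ]≔ ⊤ [ j ]≔ (C ! j) ≡⟨ cong (_[ j ]≔ (C ! j)) off≡ ⟩
      C [ j ]≔ ⊤ [ j ]≔ (C ! j) ≡⟨ reset C (C ! j) ⟩
      C [ j ]≔ (C ! j) ≡⟨ []≔-lookup C j ⟩
      C                ∎
      where
      open ≡-Reasoning
      reset : ∀ (B : Box ks) A → B [ j ]≔ ⊤ [ j ]≔ A ≡ B [ j ]≔ A
      reset B A = []≔-idempotent B j ⊤ A
      off≡ : B [ j ]≔ ⊤ ≡ C [ j ]≔ ⊤
      off≡ = trans (sym ([]≔-idempotent B j (side B) ⊤))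
               (trans (cong (_[ j ]≔ ⊤) eq) ([]≔-idempotent C j (side C) ⊤))
      side≡ : B ! j ≡ C ! j
      side≡ = transport-injective (common S B j) (common S′ B j)
        (⊆common {S = S} B j B⊆S)
        (subst (C ! j ⊆_) (common-cong S j (sym off≡)) (⊆common {S = S} C j C⊆S))
        (le B box)
        (begin
          side B ≡⟨ []≔-updates B j (side B) ⟨
          move B ! j ≡⟨ cong (_! j) eq ⟩
          move C ! j ≡⟨ []≔-updates C j (side C) ⟩
          side C ≡⟨ cong₂ (λ p q → transport p q (C ! j)) (common-cong S j off≡) (common-cong S′ j off≡) ⟨
          transport (common S B j) (common S′ B j) (C ! j) ∎)

-- Ranks and initial segments.

below? : (P : Subset n) (a : Fin n) → Decidable (λ c → c ∈ P × c < a)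
below? P a c = c ∈? P ×-dec c <? a

rank : Subset n → Fin n → ℕ
rank P a = ∣ ⟦ below? P a ⟧ ∣

rank-zero : (P : Subset (suc n)) → rank P zero ≡ 0
rank-zero {n} P = trans (cong ∣_∣ (Empty-unique λ (_ , c∈) → ℕ.n≮0 (proj₂ (∈⟦⟧⁻ (below? P zero) c∈))))
                        (∣⊥∣≡0 (suc n))

segment : ℕ → Subset n → Subset n
segment zero    P             = ⊥
segment (suc r) []            = []
segment (suc r) (outside ∷ P) = outside ∷ segment (suc r) P
segment (suc r) (inside  ∷ P) = inside ∷ segment r P

∣segment∣≤ : ∀ r (P : Subset n) → ∣ segment r P ∣ ≤ r
∣segment∣≤ {n} zero P = ℕ.≤-reflexive (∣⊥∣≡0 n)
∣segment∣≤ (suc r) []            = z≤n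
∣segment∣≤ (suc r) (outside ∷ P) = ∣segment∣≤ (suc r) P
∣segment∣≤ (suc r) (inside  ∷ P) = s≤s (∣segment∣≤ r P)

≤∣segment∣ : ∀ {r} (P : Subset n) → r ≤ ∣ P ∣ → r ≤ ∣ segment r P ∣
≤∣segment∣ {r = zero}  P             le = z≤n
≤∣segment∣ {r = suc r} (outside ∷ P) le = ≤∣segment∣ P le
≤∣segment∣ {r = suc r} (inside  ∷ P) le = s≤s (≤∣segment∣ P (ℕ.s≤s⁻¹ le))

-- `pushAlong` compares a rank with the size of a fibre. This lemma and its converse translate such
-- a test into membership in an initial segment.
∈segment⁻ : ∀ {r} (P : Subset n) {a} → a ∈ segment r P → a ∈ P × rank P a ℕ.< r
∈segment⁻ {r = zero}  P a∈ = contradiction a∈ ∉⊥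
∈segment⁻ {r = suc r} (outside ∷ P) (there a∈) = let p , q = ∈segment⁻ P a∈ in there p , q
∈segment⁻ {r = suc r} (inside ∷ P) here = here , subst (ℕ._< suc r) (sym (rank-zero (inside ∷ P))) (s≤s z≤n)
∈segment⁻ {r = suc r} (inside ∷ P) (there a∈) = let p , q = ∈segment⁻ P a∈ in there p , s≤s q

∈segment⁺ : ∀ {r} {P : Subset n} {a} → a ∈ P → rank P a ℕ.< r → a ∈ segment r P
∈segment⁺ {r = suc r} here lt = here
∈segment⁺ {r = suc r} {inside ∷ P} (there a∈) (s≤s lt) = there (∈segment⁺ a∈ lt)
∈segment⁺ {r = suc r} {outside ∷ P} (there a∈) lt = there (∈segment⁺ a∈ lt)

-- Push downs in one coordinate.

Singletons : Partition n → Set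
Singletons α = ∀ b {a a′} → a ∈ block α b → a′ ∈ block α b → a ≡ a′

-- Covers the one-dimensional minor-subproducts and also `axis j` for a factor with one element,
-- which is not `OneDimensional`.
SingletonsOff : {ks : Vec ℕ m} → GenPartition ks → Fin m → Set
SingletonsOff Λ j = ∀ l → l ≢ j → Singletons (Λ ! l)

box-point : {B : Box ks} → IsBox B → ∃ λ x → x ∈ᵇ B
box-point {ks = ks} {B} box = lookup⁻ (proj₁ ∘ box) ,
  λ l → subst (_∈ B ! l) (sym (!∘lookup⁻ {ks = ks} (proj₁ ∘ box) l)) (proj₂ (box l))

fibre? : (S : Region ks) → ∀ j A x → Decidable (λ c → c ∈ A × x [ j ]≔ c ∈ʳ S)
fibre? S j A x c = c ∈? A ×-dec T? (S (x [ j ]≔ c))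

fibre : Region ks → ∀ j → Subset _ → Point ks → Subset _
fibre S j A x = ⟦ fibre? S j A x ⟧

module Push {m : ℕ} {ks : Vec ℕ m} (Λ : GenPartition ks) (j : Fin m) (thin : SingletonsOff Λ j)
            (S : Region ks) where

  private
    α = Λ ! j

  -- Off `j` the blocks are singletons, so the cell of `x` is the part of a line in direction `j`
  -- that lies over one block. The block is a parameter `b`, which can stay fixed while `x` varies
  -- over a box.
  count-cell : ∀ x {b} → x ! j ∈ block α b → {Q : Pred (Point ks) 0ℓ} (Q? : Decidable Q)
               {R : Pred (Fin _) 0ℓ} (R? : Decidable R) →
               (∀ a → (Q (x [ j ]≔ a) → R a) × (R a → Q (x [ j ]≔ a))) →
               count (λ y → inCell? Λ (cellOf Λ x) y ×-dec Q? y) ≡ ∣ ⟦ (λ a → a ∈? block α b ×-dec R? a) ⟧ ∣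
  count-cell x {b} x∈ Q? R? iff = count-line _ x j (λ a → a ∈? block α _ ×-dec R? a)
    (λ { y (y∈ , _) → trans
      ([]≔-ext x y (y ! j) λ l l≢j → thin l l≢j _ (∈-blockOf (Λ ! l) (x ! l)) (y∈ l))
      ([]≔-lookup y j) })
    (λ a → (λ { (in-cell , q) →
               subst (a ∈_) block≡ ([]≔-at (λ l c → c ∈ block (Λ ! l) (cellOf Λ x l)) x in-cell) ,
               proj₁ (iff a) q })
         , (λ { (a∈ , r) →
               []≔-elim (λ l c → c ∈ block (Λ ! l) (cellOf Λ x l)) x a
                 (subst (a ∈_) (sym block≡) a∈) (λ l _ → ∈-blockOf (Λ ! l) (x ! l)) ,
               proj₂ (iff a) r }))
    where
    block≡ : block α (cellOf Λ x j) ≡ block α b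
    block≡ = cong (block α) (blockOf-unique α x∈)

  rank<fibre : Point ks → ∀ b → Fin _ → Set
  rank<fibre x b a = rank (block α b) a ℕ.< ∣ fibre S j (block α b) x ∣

  module _ (x : Point ks) {b : Fin (size α)} (x∈ : x ! j ∈ block α b) where

    private
      below≡ : count (λ y → inCell? Λ (cellOf Λ x) y ×-dec (y ! j <? x ! j)) ≡ rank (block α b) (x ! j)
      below≡ = count-cell x x∈ (λ y → y ! j <? x ! j) (λ c → c <? x ! j) λ a →
        subst (_< x ! j) ([]≔-updates x j a) , subst (_< x ! j) (sym ([]≔-updates x j a))

      fibre≡ : count (λ y → inCell? Λ (cellOf Λ x) y ×-dec T? (S y)) ≡ ∣ fibre S j (block α b) x ∣
      fibre≡ = count-cell x x∈ (λ y → T? (S y)) (λ c → T? (S (x [ j ]≔ c))) λ a → id , id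

    push⁻ : x ∈ʳ pushAlong Λ j S → rank<fibre x b (x ! j)
    push⁻ x∈S = subst₂ ℕ._<_ below≡ fibre≡ (ℕ.<ᵇ⇒< _ _ x∈S)

    push⁺ : rank<fibre x b (x ! j) → x ∈ʳ pushAlong Λ j S
    push⁺ lt = ℕ.<⇒<ᵇ (subst₂ ℕ._<_ (sym below≡) (sym fibre≡) lt)

  fibre-update : ∀ x A a → fibre S j A (x [ j ]≔ a) ≡ fibre S j A x
  fibre-update x A a = tabulate-cong λ c → cong (λ y → does (c ∈? A ×-dec T? (S y))) ([]≔-idempotent x j a c)

  module _ (x : Point ks) {a : Fin (suc (lookup ks j))} {b : Fin (size α)} (a∈ : a ∈ block α b) where
    private
      A = block α b
      upd = []≔-updates x j a

    push-update⁻ : x [ j ]≔ a ∈ʳ pushAlong Λ j S → rank<fibre x b a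
    push-update⁻ x∈S = subst₂ ℕ._<_ (cong (rank A) upd) (cong ∣_∣ (fibre-update x A a))
      (push⁻ (x [ j ]≔ a) (subst (_∈ A) (sym upd) a∈) x∈S)

    push-update⁺ : rank<fibre x b a → x [ j ]≔ a ∈ʳ pushAlong Λ j S
    push-update⁺ lt = push⁺ (x [ j ]≔ a) (subst (_∈ A) (sym upd) a∈)
      (subst₂ ℕ._<_ (sym (cong (rank A) upd)) (sym (cong ∣_∣ (fibre-update x A a))) lt)

  S↓ : Region ks
  S↓ = pushAlong Λ j S

  module _ (B : Box ks) (box : IsBox B) (b : Fin (size α)) where
    private
      A = block α b
      C = common S B j ∩ A
      r = ∣ C ∣

    -- Every fibre over `B` contains `C`, so it has at least `r` elements in the block, and its push
    -- down includes the first `r` elements of the block.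
    segment⊆common↓ : segment r A ⊆ common S↓ B j ∩ A
    segment⊆common↓ {a} a∈seg = x∈p∩q⁺ (∈⟦⟧⁺ (common? S↓ B j) pushed , a∈A)
      where
      a∈A    = proj₁ (∈segment⁻ {r = r} A a∈seg)
      rank<r = proj₂ (∈segment⁻ {r = r} A a∈seg)
      pushed : ∀ x → x ∈ᵇ B [ j ]≔ ⊤ → x [ j ]≔ a ∈ʳ S↓
      pushed x x∈ = push-update⁺ x a∈A (ℕ.<-≤-trans rank<r (p⊆q⇒∣p∣≤∣q∣ λ c∈ →
        let c∈common , c∈A = x∈p∩q⁻ (common S B j) A c∈ in
        ∈⟦⟧⁺ (fibre? S j A x) (c∈A , ∈⟦⟧⁻ (common? S B j) c∈common x x∈)))

    common≤common↓ : r ≤ ∣ common S↓ B j ∩ A ∣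
    common≤common↓ = ℕ.≤-trans (≤∣segment∣ A (∣p∩q∣≤∣q∣ (common S B j) A)) (p⊆q⇒∣p∣≤∣q∣ segment⊆common↓)

    -- If a ∈ A of rank at least r lies in every pushed fibre over B, each fibre
    -- meets A outside C, so by ampleness they do so in a common element.
    common↓⊆segment : Ample S → common S↓ B j ∩ A ⊆ segment r A
    common↓⊆segment ample {a} a∈ = ∈segment⁺ {r = r} a∈A (ℕ.≰⇒> high)
      where
      a∈common = proj₁ (x∈p∩q⁻ (common S↓ B j) A a∈)
      a∈A      = proj₂ (x∈p∩q⁻ (common S↓ B j) A a∈)
      high : ¬ r ≤ rank A a
      high r≤ = x∈∁p⇒x∉p (proj₂ (x∈p∩q⁻ A (∁ C) c∈)) c∈C
        where
        D : Box ks
        D = B [ j ]≔ (A ∩ ∁ C)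
        -- If the fibre of `x` in `A` were contained in `C`, its size would be at most `r`, hence at
        -- most the rank of `a`, and `a` would not be in the pushed fibre.
        extra : ∀ x → x ∈ᵇ B [ j ]≔ ⊤ → ∃ λ c → c ∈ A ∩ ∁ C × x [ j ]≔ c ∈ʳ S
        extra x x∈ = decidable-stable (Fin.any? λ c → c ∈? A ∩ ∁ C ×-dec T? (S (x [ j ]≔ c))) λ none →
          ℕ.<⇒≱ (push-update⁻ x a∈A (∈⟦⟧⁻ (common? S↓ B j) a∈common x x∈))
            (ℕ.≤-trans (p⊆q⇒∣p∣≤∣q∣ λ {c} c∈ → decidable-stable (c ∈? C) λ c∉C →
              let c∈A , xc∈S = ∈⟦⟧⁻ (fibre? S j A x) c∈ in
              none (c , x∈p∩q⁺ (c∈A , x∉p⇒x∈∁p c∉C) , xc∈S)) r≤)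
        D-box : IsBox D
        D-box = []≔-elim (λ _ → Nonempty) B _
          -- A point of `B` provides an element of `A ∩ ∁ C`, which is thereby nonempty.
          (let x , x∈ = box-point {B = B} box
               c , c∈ , _ = extra x ([]≔ᵇ-∈ x B ∈⊤ λ l _ → x∈ l)
           in c , c∈)
          (λ l _ → box l)
        hit : ∃ λ c → c ∈ D ! j × (∀ x → x ∈ᵇ D → x [ j ]≔ c ∈ʳ S)
        hit = ample⇒common ample {D} D-box j λ x x∈ →
          let c , c∈ , xc∈S = extra x ([]≔ᵇ-∈ x B ∈⊤ (∈ᵇ-off x B x∈)) in
          c , subst (c ∈_) (sym ([]≔-updates B j _)) c∈ , xc∈S
        c   = proj₁ hit
        c∈  : c ∈ A ∩ ∁ C
        c∈  = subst (c ∈_) ([]≔-updates B j _) (proj₁ (proj₂ hit))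
        c∈C : c ∈ C
        c∈C = x∈p∩q⁺ (∈⟦⟧⁺ (common? S B j) in-S , proj₁ (x∈p∩q⁻ A (∁ C) c∈))
          where
          in-S : ∀ x → x ∈ᵇ B [ j ]≔ ⊤ → x [ j ]≔ c ∈ʳ S
          -- Coordinate `j` of `x` is arbitrary, so `x` is first brought into `D` by setting it to
          -- `c`.
          in-S x x∈ = subst (_∈ʳ S) ([]≔-idempotent x j c c)
            (proj₂ (proj₂ hit) (x [ j ]≔ c) ([]≔-∈ᵇ x B (∈ᵇ-off x B x∈) c∈))

    common↓≤common : Ample S → ∣ common S↓ B j ∩ A ∣ ≤ r
    common↓≤common ample = ℕ.≤-trans (p⊆q⇒∣p∣≤∣q∣ (common↓⊆segment ample)) (∣segment∣≤ r A)

  f≤f↓ : ∀ i → f S i ≤ f S↓ i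
  f≤f↓ = f-mono j λ B box → ∣∣-blockwise α (common≤common↓ B box)

  f↓≤f : Ample S → ∀ i → f S↓ i ≤ f S i
  f↓≤f ample = f-mono j λ B box → ∣∣-blockwise α λ b → common↓≤common B box b ample

-- One-dimensional partitions and axes.

size≡1⇒singletons : (α : Partition n) → (∀ b → ∣ block α b ∣ ≡ 1) → Singletons α
size≡1⇒singletons α size≡1 b {a} {a′} a∈ a′∈ = decidable-stable (a ≟ a′) λ a≢a′ → ℕ.<⇒≱
  (subst (∣ block α b - a ∣ ℕ.<_) (size≡1 b) (x∈p⇒∣p-x∣<∣p∣ a∈))
  (x∈p⇒0<∣p∣ (x∈p∧x≢y⇒x∈p-y a′∈ (a≢a′ ∘ sym)))

oneDimensional⇒singletonsOff : (Λ : GenPartition ks) (od : OneDimensional Λ) → SingletonsOff Λ (proj₁ od)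
oneDimensional⇒singletonsOff Λ (j , _ , unique-j) l l≢j = size≡1⇒singletons (Λ ! l) λ b →
  decidable-stable (_ ℕ.≟ 1) λ ≢1 → l≢j (sym (unique-j (b , ≢1)))

discrete-singletons : ∀ n → Singletons (discrete n)
discrete-singletons n b a∈ a′∈ = trans (x∈⁅y⁆⇒x≡y b a∈) (sym (x∈⁅y⁆⇒x≡y b a′∈))

universal-! : {P : ℕ → Set} (p : ∀ k → P k) (ks : Vec ℕ m) → ∀ l → universal {P = P} p ks ! l ≡ p (lookup ks l)
universal-! p (_ ∷ ks) zero    = refl
universal-! p (_ ∷ ks) (suc l) = universal-! p ks l

axis-singletonsOff : (ks : Vec ℕ m) (j : Fin m) → SingletonsOff {ks = ks} (axis j) j
axis-singletonsOff (k ∷ ks) zero    zero    l≢j = contradiction refl l≢j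
axis-singletonsOff (k ∷ ks) zero    (suc l) l≢j =
  subst Singletons (sym (universal-! (λ k → discrete (suc k)) ks l)) (discrete-singletons _)
axis-singletonsOff (k ∷ ks) (suc j) zero    l≢j = discrete-singletons (suc k)
axis-singletonsOff (k ∷ ks) (suc j) (suc l) l≢j = axis-singletonsOff ks j l (l≢j ∘ cong suc)

axis-block : (ks : Vec ℕ m) (j : Fin m) → ∃ λ b → ∀ a → a ∈ block (axis {ks = ks} j ! j) b
axis-block (k ∷ ks) zero    = zero , λ _ → ∈⊤
axis-block (k ∷ ks) (suc j) = axis-block ks j

-- Closure under resetting coordinates to zero.

ZeroClosed : Fin m → {ks : Vec ℕ m} → Region ks → Set
ZeroClosed l S = ∀ x → x ∈ʳ S → x [ l ]≔ zero ∈ʳ S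

module _ {m : ℕ} {ks : Vec ℕ m} (j : Fin m) (S : Region ks) where
  private
    module ↓ = Push (axis j) j (axis-singletonsOff ks j) S
    b  = proj₁ (axis-block ks j)
    ∈b = proj₂ (axis-block ks j)
    A  = block (axis {ks = ks} j ! j) b

    -- Zero has rank 0, so it enters the push down of every nonempty fibre.
    zero∈↓ : ∀ x → 0 ℕ.< ∣ fibre S j A x ∣ → x [ j ]≔ zero ∈ʳ S ↓ j
    zero∈↓ x 0< = ↓.push-update⁺ x (∈b zero) (subst (ℕ._< ∣ fibre S j A x ∣) (sym (rank-zero A)) 0<)

  ↓-nonempty : ∃ (_∈ʳ S) → ∃ (_∈ʳ (S ↓ j))
  ↓-nonempty (x , x∈) = x [ j ]≔ zero , zero∈↓ x
    (x∈p⇒0<∣p∣ (∈⟦⟧⁺ (fibre? S j A x) {x ! j} (∈b (x ! j) , subst (_∈ʳ S) (sym ([]≔-lookup x j)) x∈)))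

  ↓-zeroClosed : ZeroClosed j (S ↓ j)
  ↓-zeroClosed x x∈ = zero∈↓ x (ℕ.≤-<-trans z≤n (↓.push⁻ x (∈b (x ! j)) x∈))

  -- Closure in `l` embeds the fibre of `x` in the fibre of its reset. After pushing, both are
  -- initial segments, and the larger one still contains the smaller.
  ↓-preserves-zeroClosed : ∀ {l} → l ≢ j → ZeroClosed l S → ZeroClosed l (S ↓ j)
  ↓-preserves-zeroClosed {l} l≢j closed x x∈ = ↓.push⁺ (x [ l ]≔ zero) (∈b _)
    (subst (λ a → rank A a ℕ.< ∣ fibre S j A (x [ l ]≔ zero) ∣) (sym ([]≔-minimal x zero (l≢j ∘ sym)))
      (ℕ.<-≤-trans (↓.push⁻ x (∈b (x ! j)) x∈) (p⊆q⇒∣p∣≤∣q∣ λ {c} c∈ →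
        let c∈A , xc∈S = ∈⟦⟧⁻ (fibre? S j A x) c∈ in
        ∈⟦⟧⁺ (fibre? S j A (x [ l ]≔ zero))
          (c∈A , subst (_∈ʳ S) (sym ([]≔-commutes x zero c l≢j)) (closed _ xc∈S)))))

-- The disjunction is the invariant: each relevant coordinate is still to be pushed or is already
-- closed.
foldl-↓ : {ks : Vec ℕ m} (js : List (Fin m)) (S : Region ks) → ∃ (_∈ʳ S) →
          ∃ (_∈ʳ foldl _↓_ S js) ×
          (∀ l → l List.∈ js ⊎ ZeroClosed l S → ZeroClosed l (foldl _↓_ S js))
foldl-↓ []       S x∈ = x∈ , λ { l (inj₂ closed) → closed }
foldl-↓ (j ∷ js) S x∈ = proj₁ rec , λ l → proj₂ rec l ∘ step l
  where
  rec = foldl-↓ js (S ↓ j) (↓-nonempty j S x∈)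
  step : ∀ l → l List.∈ j ∷ js ⊎ ZeroClosed l S → l List.∈ js ⊎ ZeroClosed l (S ↓ j)
  step l (inj₁ (there l∈)) = inj₁ l∈
  step l (inj₁ (here refl)) = inj₂ (↓-zeroClosed l S)
  step l (inj₂ closed) with l ≟ j
  ... | yes refl = inj₂ (↓-zeroClosed l S)
  ... | no  l≢j  = inj₂ (↓-preserves-zeroClosed j S l≢j closed)

-- From closure to bouquets.

module _ {m : ℕ} {ks : Vec ℕ m} {S : Region ks} (closed : ∀ l → ZeroClosed l S) where

  -- Coordinates are reset one after another. The second alternative records those that are already
  -- zero, which further resets leave at zero.
  zero-coordinates : ∀ is x → x ∈ʳ S →
                     ∃ λ y → y ∈ʳ S × (∀ l → l List.∈ is ⊎ x ! l ≡ zero → y ! l ≡ zero)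
  zero-coordinates []       x x∈ = x , x∈ , λ { l (inj₂ eq) → eq }
  zero-coordinates (i ∷ is) x x∈ with zero-coordinates is (x [ i ]≔ zero) (closed i x x∈)
  ... | y , y∈ , zeros = y , y∈ , λ l → zeros l ∘ step l
    where
    step : ∀ l → l List.∈ i ∷ is ⊎ x ! l ≡ zero → l List.∈ is ⊎ x [ i ]≔ zero ! l ≡ zero
    step l (inj₁ (there l∈)) = inj₁ l∈
    step l (inj₁ (here refl)) = inj₂ ([]≔-updates x l zero)
    step l (inj₂ eq) = inj₂ ([]≔-elim (λ l a → x ! l ≡ zero → a ≡ zero) x zero (λ _ → refl) (λ _ _ → id) l eq)

  origin! : ∀ l → origin {ks = ks} ! l ≡ zero
  origin! = universal-! (λ _ → zero) ks

  zeroClosed⇒bouquet : ∃ (_∈ʳ S) → BouquetOfPrisms S origin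
  zeroClosed⇒bouquet (x , x∈) = origin∈ , λ { B (box , B⊆S , maximal) l →
    subst (_∈ B ! l) (sym (origin! l)) (zero∈ B box B⊆S maximal l) }
    where
    origin∈ : origin ∈ʳ S
    origin∈ with zero-coordinates (allFin m) x x∈
    ... | y , y∈ , zeros = subst (_∈ʳ S)
      (!-ext λ l → trans (zeros l (inj₁ (∈-allFin l))) (sym (origin! l))) y∈
    zero∈ : ∀ B → IsBox B → B ⊆ʳ S → (∀ C → IsBox C → C ⊆ʳ S → B ⊆ᵇ C → C ⊆ᵇ B) → ∀ l → zero ∈ B ! l
    zero∈ B box B⊆S maximal l =
      let y , y∈ = box-point {B = B} box in
      -- By maximality the enlarged box `C` lies in `B`, and a point of `C` with coordinate `l`
      -- equal to zero shows that zero is in that side of `B`.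
      []≔-at (λ i a → a ∈ B ! i) y
        (maximal C C-box C⊆S B⊆C (y [ l ]≔ zero) ([]≔-∈ᵇ y B (λ i _ → y∈ i) (q⊆p∪q (B ! l) ⁅ zero ⁆ (x∈⁅x⁆ zero))))
      where
      C : Box ks
      C = B [ l ]≔ (B ! l ∪ ⁅ zero ⁆)
      C-box : IsBox C
      C-box = []≔-elim (λ _ → Nonempty) B _ (zero , q⊆p∪q (B ! l) ⁅ zero ⁆ (x∈⁅x⁆ zero)) (λ i _ → box i)
      B⊆C : B ⊆ᵇ C
      B⊆C y y∈ = []≔ᵇ-∈ y B (p⊆p∪q ⁅ zero ⁆ (y∈ l)) (λ i _ → y∈ i)
      C⊆S : C ⊆ʳ S
      C⊆S y y∈ with ∈ᵇ-off y B y∈ | x∈p∪q⁻ (B ! l) ⁅ zero ⁆ (∈ᵇ-at y B y∈)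
      ... | off | inj₁ yl∈ = subst (_∈ʳ S) ([]≔-lookup y l) (B⊆S _ ([]≔-∈ y B off yl∈))
      -- A point of `C` with coordinate `l` zero is the reset of a point of `B`, obtained by putting
      -- any element of side `l` there.
      ... | off | inj₂ yl∈ = subst (_∈ʳ S)
        (trans ([]≔-idempotent y l (proj₁ (box l)) zero)
          (trans (cong (y [ l ]≔_) (sym (x∈⁅y⁆⇒x≡y zero yl∈))) ([]≔-lookup y l)))
        (closed l _ (B⊆S _ ([]≔-∈ y B off (proj₂ (box l)))))

proposition3 : ∀ {m : ℕ} (ks : Vec ℕ m) (S : Region ks) →
    (∀ (Λ : GenPartition ks) (one-dim : OneDimensional Λ) (i : ℕ) →
    f S i ≤ f (S [ Λ , one-dim ↓]) i)
    ×
    (Ample S →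
    (∀ (Λ : GenPartition ks) (one-dim : OneDimensional Λ) →
    f S ≗ f (S [ Λ , one-dim ↓]))
    ×
    (∃ (λ x → x ∈ʳ S) →
    ∀ (σ : Permutation′ m) →
    BouquetOfPrisms (serialPush σ S) origin))
proposition3 {m} ks S = increase , λ ample →
  (λ Λ od i → ℕ.≤-antisym (increase Λ od i) (Push.f↓≤f Λ _ (oneDimensional⇒singletonsOff Λ od) S ample i)) ,
  λ x∈ σ →
    let nonempty , closed = foldl-↓ (List.map (σ ⟨$⟩ʳ_) (allFin m)) S x∈ in
    zeroClosed⇒bouquet
      -- Every coordinate is pushed at some stage, since `σ` takes the preimage of `l` to `l`.
      (λ l → closed l (inj₁ (subst (List._∈ _) (inverseʳ σ) (∈-map⁺ (σ ⟨$⟩ʳ_) (∈-allFin (σ ⟨$⟩ˡ l))))))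
      nonempty
  where
  increase : ∀ (Λ : GenPartition ks) (od : OneDimensional Λ) i → f S i ≤ f (S [ Λ , od ↓]) i
  increase Λ od = Push.f≤f↓ Λ _ (oneDimensional⇒singletonsOff Λ od) S
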